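{- Let $n\ge 1$ and let $L=(L_{ij})_{1\le i,j\le n}$ be an $n\times n$ Laplace-like matrix with real or complex entries, i.e. $L$ is symmetric and $\sum_{j=1}^n L_{ij}=0$ for every $i$. Let $C(L)$ denote the common value of all the cofactors of $L$. Then $$C(L)=(-1)^{n+1}\sum_{\tau}A_\tau(L),$$ where the sum is taken over all trees $\tau$ whose set of vertices is $\{1,\dots,n\}$, and $$A_\tau(L)=\prod_{i<j,\ \{i,j\}\in \mathrm{Edges}(\tau)}L_{ij}.$$
   Context: For an $n\times n$ matrix $L=(L_{ij})$, $M_{ij}(L)$ denotes the submatrix obtained by deleting the $i$-th row and the $j$-th column, and the $i,j$ cofactor of $L$ is $C_{ij}(L)=(-1)^{i+j}\det M_{ij}(L)$ (the determinant of the empty matrix is $1$, and an empty product is $1$). A matrix $L$ is called Laplace-like if it is symmetric and each of its rows sums to zero. If $L$ is Laplace-like then all its cofactors $C_{ij}(L)$ are equal, and $C(L)$ denotes their common value. Trees are undirected labelled trees: two trees on $\{1,\dots,n\}$ are the same if and only if they have the same edge set. $\mathrm{Edges}(\tau)$ is the set of edges of $\tau$, each edge being a two-element subset $\{i,j\}\subset\{1,\dots,n\}$. -}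

module Defs where

open import Algebra.Bundles using (CommutativeRing)
import Algebra.Properties.Monoid.Sum as MonoidSum
import Algebra.Properties.Semiring.Exp as SemiringExp
open import Data.Fin using (Fin; zero; suc; toℕ; punchIn; _<_)
import Data.Fin.Properties as Fin
open import Data.List
  using (List; []; _∷_; _++_; _∷ʳ_; [_]; map; filter; foldr; length; lookup; allFin; cartesianProduct)
open import Data.List.Membership.Propositional using (_∈_)
open import Data.List.Membership.Propositional.Properties using (∈-lookup)
open import Data.List.Relation.Unary.All as All using ()
open import Data.List.Relation.Unary.AllPairs using (_∷_)
open import Data.List.Relation.Unary.Any using (here; there)
open import Data.List.Relation.Unary.Linked using (Linked; linked?)
open import Data.List.Relation.Unary.Unique.Propositional using (Unique)
open import Data.Nat using (ℕ; zero; suc; _+_; _≤_; _≤?_; z≤n; s≤s)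
open import Data.Nat.Properties using (≤-trans; n≤1+n)
open import Data.Product using (∃; _×_; _,_)
import Data.Product.Properties as Product
open import Data.Sum using (_⊎_; inj₁; inj₂)
open import Data.Vec.Functional using (Vector)
open import Relation.Binary.Construct.Closure.ReflexiveTransitive as Star
  using (Star; ε; _◅_; _◅◅_)
open import Relation.Binary.PropositionalEquality using (_≡_; refl; sym; cong)
open import Relation.Nullary using (Dec; yes; no; ¬_; contradiction)
open import Relation.Nullary.Decidable using (map′; ¬?; _×-dec_; _⊎-dec_)

import Data.List.Membership.DecPropositional as DecMembership
import Data.List.Relation.Unary.Unique.DecPropositional as DecUnique

------------------------------------------------------------------------
-- Graphs on the vertex set Fin n

-- The two-element subset {i,j} with i < j is represented by the pair (i , j).
EdgeSet : ℕ → Set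
EdgeSet n = List (Fin n × Fin n)

pairs : ∀ n → EdgeSet n
pairs n = filter (λ (i , j) → i Fin.<? j) (cartesianProduct (allFin n) (allFin n))

sublists : ∀ {a} {A : Set a} → List A → List (List A)
sublists []       = [ [] ]
sublists (x ∷ xs) = map (x ∷_) (sublists xs) ++ sublists xs

-- `pairs n` lists every two-element subset of Fin n exactly once, so its
-- sublists are the edge sets of the simple graphs on Fin n, each occurring
-- exactly once.
graphs : ∀ n → List (EdgeSet n)
graphs n = sublists (pairs n)

Adj : ∀ {n} → EdgeSet n → Fin n → Fin n → Set
Adj E i j = (i , j) ∈ E ⊎ (j , i) ∈ E

Connected : ∀ {n} → EdgeSet n → Set
Connected E = ∀ i j → Star (Adj E) i j

-- The distinct vertices x ∷ xs, at least three in number, in cyclic order.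
IsCycle : ∀ {n} → EdgeSet n → Fin n → List (Fin n) → Set
IsCycle E x xs = 2 ≤ length xs × Unique (x ∷ xs) × Linked (Adj E) (x ∷ (xs ∷ʳ x))

Acyclic : ∀ {n} → EdgeSet n → Set
Acyclic E = ∀ x xs → ¬ IsCycle E x xs

IsTree : ∀ {n} → EdgeSet n → Set
IsTree E = Connected E × Acyclic E

------------------------------------------------------------------------
-- Decidability of being a tree

adj? : ∀ {n} (E : EdgeSet n) i j → Dec (Adj E i j)
adj? E i j = ((i , j) ∈? E) ⊎-dec ((j , i) ∈? E)
  where open DecMembership (Product.≡-dec Fin._≟_ Fin._≟_) using (_∈?_)

module _ {n} (a b : Fin n) (E : EdgeSet n) where

  Through : Fin n → Fin n → Set
  Through i j = Star (Adj E) i j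
    ⊎ (Star (Adj E) i a × Star (Adj E) b j)
    ⊎ (Star (Adj E) i b × Star (Adj E) a j)

  weaken : ∀ {i j} → Star (Adj E) i j → Star (Adj ((a , b) ∷ E)) i j
  weaken = Star.map λ { (inj₁ p) → inj₁ (there p) ; (inj₂ p) → inj₂ (there p) }

  fromThrough : ∀ {i j} → Through i j → Star (Adj ((a , b) ∷ E)) i j
  fromThrough (inj₁ p)              = weaken p
  fromThrough (inj₂ (inj₁ (p , q))) = weaken p ◅◅ (inj₁ (here refl) ◅ weaken q)
  fromThrough (inj₂ (inj₂ (p , q))) = weaken p ◅◅ (inj₂ (here refl) ◅ weaken q)

  step : ∀ {i k j} → Adj E i k → Through k j → Through i j
  step e (inj₁ p)              = inj₁ (e ◅ p)
  step e (inj₂ (inj₁ (p , q))) = inj₂ (inj₁ (e ◅ p , q))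
  step e (inj₂ (inj₂ (p , q))) = inj₂ (inj₂ (e ◅ p , q))

  stepᵃᵇ : ∀ {j} → Through b j → Through a j
  stepᵃᵇ (inj₁ p)              = inj₂ (inj₁ (ε , p))
  stepᵃᵇ (inj₂ (inj₁ (_ , q))) = inj₂ (inj₁ (ε , q))
  stepᵃᵇ (inj₂ (inj₂ (_ , q))) = inj₁ q

  stepᵇᵃ : ∀ {j} → Through a j → Through b j
  stepᵇᵃ (inj₁ p)              = inj₂ (inj₂ (ε , p))
  stepᵇᵃ (inj₂ (inj₁ (_ , q))) = inj₁ q
  stepᵇᵃ (inj₂ (inj₂ (_ , q))) = inj₂ (inj₂ (ε , q))

  toThrough : ∀ {i j} → Star (Adj ((a , b) ∷ E)) i j → Through i j
  toThrough ε                          = inj₁ ε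
  toThrough (inj₁ (here refl) ◅ p)     = stepᵃᵇ (toThrough p)
  toThrough (inj₂ (here refl) ◅ p)     = stepᵇᵃ (toThrough p)
  toThrough (inj₁ (there e) ◅ p)       = step (inj₁ e) (toThrough p)
  toThrough (inj₂ (there e) ◅ p)       = step (inj₂ e) (toThrough p)

reachable? : ∀ {n} (E : EdgeSet n) i j → Dec (Star (Adj E) i j)
reachable? [] i j = map′ (λ { refl → ε }) (λ { ε → refl ; (inj₁ () ◅ _) ; (inj₂ () ◅ _) }) (i Fin.≟ j)
reachable? ((a , b) ∷ E) i j = map′ (fromThrough a b E) (toThrough a b E)
  (reachable? E i j
    ⊎-dec ((reachable? E i a ×-dec reachable? E b j)
    ⊎-dec (reachable? E i b ×-dec reachable? E a j)))

connected? : ∀ {n} (E : EdgeSet n) → Dec (Connected E)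
connected? E = Fin.all? λ i → Fin.all? λ j → reachable? E i j

isCycle? : ∀ {n} (E : EdgeSet n) x xs → Dec (IsCycle E x xs)
isCycle? E x xs =
  (2 ≤? length xs) ×-dec (unique? (x ∷ xs) ×-dec linked? (adj? E) (x ∷ (xs ∷ʳ x)))
  where open DecUnique Fin._≟_ using (unique?)

lookup-injective : ∀ {a} {A : Set a} {xs : List A} → Unique xs →
  ∀ i j → lookup xs i ≡ lookup xs j → i ≡ j
lookup-injective (_  ∷ _) zero    zero    _  = refl
lookup-injective (ap ∷ _) zero    (suc j) eq = contradiction eq (All.lookup ap (∈-lookup j))
lookup-injective (ap ∷ _) (suc i) zero    eq = contradiction (sym eq) (All.lookup ap (∈-lookup i))
lookup-injective (_  ∷ u) (suc i) (suc j) eq = cong suc (lookup-injective u i j eq)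

unique⇒length≤ : ∀ {n} {xs : List (Fin n)} → Unique xs → length xs ≤ n
unique⇒length≤ u = Fin.injective⇒≤ λ {i} {j} → lookup-injective u i j

boundedList? : ∀ {n p} {P : List (Fin n) → Set p} → (∀ xs → Dec (P xs)) →
  ∀ k → Dec (∃ λ xs → length xs ≤ k × P xs)
boundedList? P? zero = map′ (λ p → [] , z≤n , p) (λ { ([] , _ , p) → p }) (P? [])
boundedList? P? (suc k) = map′
  (λ { (inj₁ p) → [] , z≤n , p ; (inj₂ (x , xs , l , p)) → x ∷ xs , s≤s l , p })
  (λ { ([] , _ , p) → inj₁ p ; (x ∷ xs , s≤s l , p) → inj₂ (x , xs , l , p) })
  (P? [] ⊎-dec Fin.any? λ x → boundedList? (λ xs → P? (x ∷ xs)) k)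

acyclic? : ∀ {n} (E : EdgeSet n) → Dec (Acyclic E)
acyclic? {n} E = map′
  (λ ¬c x xs c → ¬c (x , xs , bound c , c))
  (λ ac (x , xs , _ , c) → ac x xs c)
  (¬? (Fin.any? λ x → boundedList? (isCycle? E x) n))
  where
  bound : ∀ {x xs} → IsCycle E x xs → length xs ≤ n
  bound (_ , u , _) = ≤-trans (n≤1+n _) (unique⇒length≤ u)

isTree? : ∀ {n} (E : EdgeSet n) → Dec (IsTree E)
isTree? E = connected? E ×-dec acyclic? E

trees : ∀ n → List (EdgeSet n)
trees n = filter isTree? (graphs n)

------------------------------------------------------------------------
-- Matrices over a commutative ring

module Matrices {c ℓ} (R : CommutativeRing c ℓ) where

  open CommutativeRing R using (Carrier; _≈_; _*_; -_; 0#; 1#; +-monoid; semiring)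
    renaming (_+_ to _⊕_)
  open MonoidSum +-monoid using (sum)
  open SemiringExp semiring using (_^_)

  Matrix : ℕ → Set c
  Matrix n = Vector (Vector Carrier n) n

  [-1]^_ : ℕ → Carrier
  [-1]^ k = (- 1#) ^ k

  infix 9 [-1]^_

  minor : ∀ {n} → Matrix (suc n) → Fin (suc n) → Fin (suc n) → Matrix n
  minor L i j k l = L (punchIn i k) (punchIn j l)

  -- Laplace expansion along the first row.
  det : ∀ {n} → Matrix n → Carrier
  det {zero}  L = 1#
  det {suc n} L = sum λ j → [-1]^ (toℕ j) * (L zero j * det (minor L zero j))

  -- Indices start at 0 here; this does not change the parity of i + j.
  cofactor : ∀ {n} → Matrix (suc n) → Fin (suc n) → Fin (suc n) → Carrier
  cofactor L i j = [-1]^ (toℕ i + toℕ j) * det (minor L i j)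

  record LaplaceLike {n} (L : Matrix n) : Set ℓ where
    field
      symmetric : ∀ i j → L i j ≈ L j i
      rowSum≈0  : ∀ i → sum (λ j → L i j) ≈ 0#

  A[_] : ∀ {n} → EdgeSet n → Matrix n → Carrier
  A[ τ ] L = foldr _*_ 1# (map (λ (i , j) → L i j) τ)

  ∑trees : ∀ n → (EdgeSet n → Carrier) → Carrier
  ∑trees n f = foldr _⊕_ 0# (map f (trees n))

{-# OPTIONS --safe #-}
module Submission where

-- Deletion–contraction, one edge at a time. When a set F of edges forming a
-- forest has been selected and the edges E are still to be examined, compare
--   * the sum, over the subsets S of E for which F ∪ S is a tree, of the weights
--     of S;
--   * a principal minor of the matrix − Σ L_ab v vᵀ over the edges (a , b) of E,
--     on the components of F, where v has the entry 1 at the component of a and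
--     − 1 at that of b.
-- An edge inside a component contributes v = 0, and selecting it would close a
-- cycle. For an edge between two components, all cofactors being equal, delete
-- the row and column of the first one: the edge then changes a single diagonal
-- entry, and the coefficient of that change is the minor of the contracted matrix.

open import Defs
open import Algebra.Bundles using (CommutativeRing)
import Algebra.Properties.CommutativeSemigroup as CommutativeSemigroupProperties
import Algebra.Properties.Ring as RingProperties
import Algebra.Properties.Semiring.Exp as SemiringExp
import Algebra.Properties.Semiring.Sum as SemiringSum
import Algebra.Solver.CommutativeMonoid as CommutativeMonoidSolver
open import Data.Bool using (true; false)
open import Data.Fin using (Fin; zero; suc; toℕ; punchIn; punchOut; _<_)
open import Data.Fin.Properties using (_≟_; _<?_; 0≢1+n; <-asym; <-cmp; <⇒≢; punchIn-punchOut; punchInᵢ≢i; punchOut-cong; punchOut-injective; punchOut-punchIn)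
open import Data.List using (List; []; _∷_; _++_; _∷ʳ_; _ʳ++_; map; filter; foldr; allFin; cartesianProduct)
import Data.List.Membership.DecPropositional as DecMembership
open import Data.List.Membership.Propositional using (_∈_)
open import Data.List.Membership.Propositional.Properties using (∈-filter⁺; ∈-cartesianProduct⁺; ∈-allFin)
import Data.List.Properties as List
open import Data.List.Relation.Binary.Subset.Propositional using (_⊆_)
open import Data.List.Relation.Unary.All as All using (All; []; _∷_)
import Data.List.Relation.Unary.All.Properties as All
open import Data.List.Relation.Unary.AllPairs using ([]; _∷_)
import Data.List.Relation.Unary.AllPairs.Properties as AllPairs
open import Data.List.Relation.Unary.Any using (here; there)
import Data.List.Relation.Unary.Any.Properties as Any
open import Data.List.Relation.Unary.Linked as Linked using (Linked; []; [-]; _∷_)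
open import Data.List.Relation.Unary.Unique.Propositional using (Unique)
import Data.List.Relation.Unary.Unique.Propositional.Properties as Unique
open import Data.Nat using (ℕ; zero; suc; _+_; s≤s; z≤n)
import Data.Nat.Properties as ℕ
open import Data.Product using (∃; _×_; _,_; proj₁; proj₂)
open import Data.Sum as Sum using (_⊎_; inj₁; inj₂; [_,_])
open import Data.Vec.Functional using (updateAt)
open import Data.Vec.Functional.Properties using (updateAt-updates; updateAt-minimal)
open import Function using (_∘_; const; flip; id)
open import Relation.Binary.Construct.Closure.ReflexiveTransitive as Star using (Star; ε; _◅_; _◅◅_)
open import Relation.Binary.Definitions using (tri<; tri≈; tri>)
open import Relation.Binary.PropositionalEquality as ≡ using (_≡_; _≢_; ≢-sym)
open import Relation.Nullary using (¬_; Dec; yes; no; does; contradiction)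

-- Determinants

-- With j = punchIn c l and k = swap c l, the pair (j , punchIn j k) of distinct
-- indices has second entry c; so (c , l) enumerates such pairs in the other order.
swap : ∀ {n} → Fin (suc n) → Fin n → Fin n
swap {suc n} zero    l       = zero
swap {suc n} (suc c) zero    = c
swap {suc n} (suc c) (suc l) = suc (swap c l)

punchIn-swap : ∀ {n} (c : Fin (suc n)) l → punchIn (punchIn c l) (swap c l) ≡ c
punchIn-swap {suc n} zero    l       = ≡.refl
punchIn-swap {suc n} (suc c) zero    = ≡.refl
punchIn-swap {suc n} (suc c) (suc l) = ≡.cong suc (punchIn-swap c l)

-- Deleting the same two indices in either order leaves the same remaining indices in the same
-- order. This identifies the double minors in `det-row`.
punchIn-punchIn-swap : ∀ {n} (c : Fin (suc (suc n))) l x →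
  punchIn (punchIn c l) (punchIn (swap c l) x) ≡ punchIn c (punchIn l x)
punchIn-punchIn-swap zero    l       x       = ≡.refl
punchIn-punchIn-swap (suc c) zero    x       = ≡.refl
punchIn-punchIn-swap (suc c) (suc l) zero    = ≡.refl
punchIn-punchIn-swap (suc c) (suc l) (suc x) = ≡.cong suc (punchIn-punchIn-swap c l x)

-- Supplies the row along which `det-equalRows` expands: it must avoid both equal rows.
third : ∀ {n} (p q : Fin (suc (suc (suc n)))) → ∃ λ r → r ≢ p × r ≢ q
third zero          zero          = suc zero , (λ ()) , λ ()
third zero          (suc zero)    = suc (suc zero) , (λ ()) , λ ()
third zero          (suc (suc _)) = suc zero , (λ ()) , λ ()
third (suc zero)    zero          = suc (suc zero) , (λ ()) , λ ()
third (suc (suc _)) zero          = suc zero , (λ ()) , λ ()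
third (suc _)       (suc _)       = zero , (λ ()) , λ ()

module Determinant {c ℓ} (R : CommutativeRing c ℓ) where

  open CommutativeRing R hiding (zero) renaming (_+_ to _⊕_)
  open Matrices R
  open RingProperties ring
  open SemiringSum semiring
  open SemiringExp semiring using (^-homo-*)
  open CommutativeSemigroupProperties *-commutativeSemigroup using (x∙yz≈y∙xz)
  open CommutativeSemigroupProperties +-commutativeSemigroup using ()
    renaming (x∙yz≈y∙xz to x+yz≈y+xz)
  open CommutativeMonoidSolver *-commutativeMonoid using (solve; _⊜_) renaming (_⊕_ to _⊗_; id to 𝟙)
  open import Relation.Binary.Reasoning.Setoid setoid

  -- Laplace expansion along rows and columns.

  sum-cong : ∀ {n} {f g : Fin n → Carrier} → (∀ i → f i ≈ g i) → sum f ≈ sum g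
  sum-cong = sum-cong-≋

  sum-zero : ∀ {n} {f : Fin n → Carrier} → (∀ i → f i ≈ 0#) → sum f ≈ 0#
  sum-zero {n} f≈0 = trans (sum-cong f≈0) (sum-replicate-zero n)

  *-*-distribˡ-sum : ∀ {n} x y (f : Fin n → Carrier) → x * (y * sum f) ≈ sum λ k → x * (y * f k)
  *-*-distribˡ-sum x y f = trans (*-congˡ (*-distribˡ-sum y f)) (*-distribˡ-sum x λ k → y * f k)

  -- Both sides run over the ordered pairs of distinct indices, grouped by first entry on the left
  -- and by second entry on the right. The pairs with first entry `zero` form `G`, those with second
  -- entry `zero` form `H`, and induction covers the rest.
  sum-swap : ∀ {n} (g : Fin (suc n) → Fin n → Carrier) →
    (sum λ j → sum λ k → g j k) ≈ (sum λ c → sum λ l → g (punchIn c l) (swap c l))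
  sum-swap {zero}  g = refl
  sum-swap {suc n} g = begin
    G ⊕ (sum λ j → g (suc j) zero ⊕ sum (λ k → g (suc j) (suc k)))
      ≈⟨ +-congˡ (∑-distrib-+ (λ j → g (suc j) zero) λ j → sum λ k → g (suc j) (suc k)) ⟩
    G ⊕ (H ⊕ (sum λ j → sum λ k → g (suc j) (suc k)))
      ≈⟨ +-congˡ (+-congˡ (sum-swap λ j k → g (suc j) (suc k))) ⟩
    G ⊕ (H ⊕ K)
      ≈⟨ x+yz≈y+xz G H K ⟩
    H ⊕ (G ⊕ K)
      ≈⟨ +-congˡ (∑-distrib-+ (λ c → g zero c) λ c → sum λ l → g (suc (punchIn c l)) (suc (swap c l))) ⟨
    H ⊕ (sum λ c → g zero c ⊕ (sum λ l → g (suc (punchIn c l)) (suc (swap c l)))) ∎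
    where
    G = sum λ k → g zero k
    H = sum λ j → g (suc j) zero
    K = sum λ c → sum λ l → g (suc (punchIn c l)) (suc (swap c l))

  det-cong : ∀ {n} {M N : Matrix n} → (∀ i j → M i j ≈ N i j) → det M ≈ det N
  det-cong {zero}  M≈N = refl
  det-cong {suc n} M≈N = sum-cong λ j → *-congˡ {x = [-1]^ toℕ j}
    (*-cong (M≈N zero j) (det-cong λ k l → M≈N (suc k) (punchIn j l)))

  cofactor-cong : ∀ {n} {M N : Matrix (suc n)} i j →
    (∀ k l → k ≢ i → l ≢ j → M k l ≈ N k l) → cofactor M i j ≈ cofactor N i j
  cofactor-cong i j M≈N = *-congˡ
    (det-cong λ k l → M≈N _ _ (punchInᵢ≢i i k) (punchInᵢ≢i j l))

  -1*-1≈1 : - 1# * - 1# ≈ 1#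
  -1*-1≈1 = trans (-1*x≈-x (- 1#)) (-‿involutive 1#)

  -- If `l` lies below `c`, then `punchIn c l` and `swap c l` have the values `l` and `c - 1`;
  -- otherwise they have the values `l + 1` and `c`. Either way their total differs from `c + l` by
  -- one.
  sign-swap : ∀ {n} (c : Fin (suc n)) l →
    [-1]^ toℕ (punchIn c l) * [-1]^ toℕ (swap c l) ≈ - 1# * ([-1]^ toℕ c * [-1]^ toℕ l)
  sign-swap {suc n} zero l = 
    solve 2 (λ x y → (x ⊗ y) ⊗ 𝟙 ⊜ x ⊗ (𝟙 ⊗ y)) refl (- 1#) ([-1]^ toℕ l)
  sign-swap {suc n} (suc c) zero = begin
    1# * s                    ≈⟨ *-congʳ -1*-1≈1 ⟨
    (- 1# * - 1#) * s         ≈⟨ solve 2 (λ x s → (x ⊗ x) ⊗ s ⊜ x ⊗ ((x ⊗ s) ⊗ 𝟙)) refl (- 1#) s ⟩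
    - 1# * ((- 1# * s) * 1#)  ∎
    where
    s = [-1]^ toℕ c
  sign-swap {suc n} (suc c) (suc l) = begin
    (- 1# * p) * (- 1# * q) ≈⟨ solve 3 (λ x p q → (x ⊗ p) ⊗ (x ⊗ q) ⊜
         (x ⊗ x) ⊗ (p ⊗ q)) refl (- 1#) p q ⟩
    (- 1# * - 1#) * (p * q) ≈⟨ *-congˡ (sign-swap c l) ⟩
    (- 1# * - 1#) * (- 1# * (r * s)) ≈⟨ solve 3 (λ x r s → (x ⊗ x) ⊗ (x ⊗ (r ⊗ s)) ⊜
         x ⊗ ((x ⊗ r) ⊗ (x ⊗ s))) refl (- 1#) r s ⟩
    - 1# * ((- 1# * r) * (- 1# * s)) ∎
    where
    p = [-1]^ toℕ (punchIn c l)
    q = [-1]^ toℕ (swap c l)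
    r = [-1]^ toℕ c
    s = [-1]^ toℕ l

  -- For a later row, each minor of the first-row expansion is expanded by induction. The double sum
  -- runs over ordered pairs of distinct columns; `sum-swap` regroups it by the column chosen in row
  -- `suc i`, and the sign from `sign-swap` accounts for the shift from `i` to `suc i`.
  det-row : ∀ {n} (M : Matrix (suc n)) i → det M ≈ sum λ j → M i j * cofactor M i j
  det-row M zero = sum-cong λ j → x∙yz≈y∙xz ([-1]^ toℕ j) (M zero j) (det (minor M zero j))
  det-row {suc n} M (suc i) = begin
    (sum λ j → [-1]^ toℕ j * (M zero j * det (minor M zero j)))
      ≈⟨ sum-cong (λ j → trans (*-congˡ {x = [-1]^ toℕ j} (*-congˡ (det-row (minor M zero j) i)))
           (*-*-distribˡ-sum ([-1]^ toℕ j) (M zero j) (e j))) ⟩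
    (sum λ j → sum λ k → g j k)
      ≈⟨ sum-swap g ⟩
    (sum λ c → sum λ l → g (punchIn c l) (swap c l))
      ≈⟨ sum-cong (λ c → sum-cong λ l → term c l) ⟩
    (sum λ c → sum λ l → M (suc i) c * ([-1]^ (suc (toℕ i) + toℕ c) * h c l))
      ≈⟨ sum-cong (λ c → *-*-distribˡ-sum (M (suc i) c) ([-1]^ (suc (toℕ i) + toℕ c)) (h c)) ⟨
    (sum λ c → M (suc i) c * cofactor M (suc i) c) ∎
    where
    e : Fin (suc (suc n)) → Fin (suc n) → Carrier
    e j k = M (suc i) (punchIn j k) * ([-1]^ (toℕ i + toℕ k) * det (minor (minor M zero j) i k))
    g : Fin (suc (suc n)) → Fin (suc n) → Carrier
    g j k = [-1]^ toℕ j * (M zero j * e j k)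
    h : Fin (suc (suc n)) → Fin (suc n) → Carrier
    h c l = [-1]^ toℕ l * (M zero (punchIn c l) * det (minor (minor M (suc i) c) zero l))
    term : ∀ c l → g (punchIn c l) (swap c l) ≈ M (suc i) c * ([-1]^ (suc (toℕ i) + toℕ c) * h c l)
    term c l = begin
      p * (m * (M (suc i) (punchIn (punchIn c l) (swap c l)) *
        ([-1]^ (toℕ i + toℕ (swap c l)) * det (minor (minor M zero (punchIn c l)) i (swap c l)))))
        ≈⟨ *-congˡ (*-congˡ (*-cong (reflexive (≡.cong (M (suc i)) (punchIn-swap c l)))
             (*-cong (^-homo-* (- 1#) (toℕ i) _) (det-cong λ x y → reflexive
               (≡.cong (M (suc (punchIn i x))) (punchIn-punchIn-swap c l y)))))) ⟩
      p * (m * (a * ((t * q) * d)))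
        ≈⟨ solve 6 (λ p m a t q d → p ⊗ (m ⊗ (a ⊗ ((t ⊗ q) ⊗ d))) ⊜
             (p ⊗ q) ⊗ (m ⊗ (a ⊗ (t ⊗ d)))) refl p m a t q d ⟩
      (p * q) * (m * (a * (t * d)))
        ≈⟨ *-congʳ (sign-swap c l) ⟩
      (- 1# * (r * s)) * (m * (a * (t * d)))
        ≈⟨ solve 7 (λ x r s m a t d → (x ⊗ (r ⊗ s)) ⊗ (m ⊗ (a ⊗ (t ⊗ d))) ⊜
             a ⊗ ((x ⊗ (t ⊗ r)) ⊗ (s ⊗ (m ⊗ d)))) refl (- 1#) r s m a t d ⟩
      a * ((- 1# * (t * r)) * (s * (m * d)))
        ≈⟨ *-congˡ (*-congʳ (*-congˡ (^-homo-* (- 1#) (toℕ i) _))) ⟨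
      a * ([-1]^ (suc (toℕ i) + toℕ c) * h c l) ∎
      where
      p = [-1]^ toℕ (punchIn c l)
      q = [-1]^ toℕ (swap c l)
      r = [-1]^ toℕ c
      s = [-1]^ toℕ l
      t = [-1]^ toℕ i
      m = M zero (punchIn c l)
      a = M (suc i) c
      d = det (minor (minor M (suc i) c) zero l)

  -- The corner entry gives the same term in both expansions. In the other terms, expanding each
  -- minor along its own first column by induction yields a double sum over one entry of the first
  -- row and one of the first column, whose order can be exchanged.
  det-column₀ : ∀ {n} (M : Matrix (suc n)) →
    det M ≈ sum λ i → [-1]^ toℕ i * (M i zero * det (minor M i zero))
  det-column₀ {zero}  M = refl
  det-column₀ {suc n} M = +-congˡ (begin
    (sum λ j → [-1]^ toℕ (suc j) * (M zero (suc j) * det (minor M zero (suc j))))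
      ≈⟨ sum-cong (λ j → trans
           (*-congˡ {x = [-1]^ toℕ (suc j)} (*-congˡ (det-column₀ (minor M zero (suc j)))))
           (*-*-distribˡ-sum ([-1]^ toℕ (suc j)) (M zero (suc j))
             λ i → [-1]^ toℕ i * (M (suc i) zero * d i j))) ⟩
    (sum λ j → sum λ i → f j i)
      ≈⟨ ∑-comm f ⟩
    (sum λ i → sum λ j → f j i)
      ≈⟨ sum-cong (λ i → sum-cong λ j →
           solve 6 (λ x s t m a d → (x ⊗ t) ⊗ (m ⊗ (s ⊗ (a ⊗ d))) ⊜
             (x ⊗ s) ⊗ (a ⊗ (t ⊗ (m ⊗ d)))) refl 
             (- 1#) ([-1]^ toℕ i) ([-1]^ toℕ j) (M zero (suc j)) (M (suc i) zero) (d i j)) ⟩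
    (sum λ i → sum λ j → g i j)
      ≈⟨ sum-cong (λ i → *-*-distribˡ-sum ([-1]^ toℕ (suc i)) (M (suc i) zero)
           λ j → [-1]^ toℕ j * (M zero (suc j) * d i j)) ⟨
    (sum λ i → [-1]^ toℕ (suc i) * (M (suc i) zero * det (minor M (suc i) zero))) ∎)
    where
    d : Fin (suc n) → Fin (suc n) → Carrier
    d i j = det λ x y → M (suc (punchIn i x)) (suc (punchIn j y))
    f : Fin (suc n) → Fin (suc n) → Carrier
    f j i = [-1]^ toℕ (suc j) * (M zero (suc j) * ([-1]^ toℕ i * (M (suc i) zero * d i j)))
    g : Fin (suc n) → Fin (suc n) → Carrier
    g i j = [-1]^ toℕ (suc i) * (M (suc i) zero * ([-1]^ toℕ j * (M zero (suc j) * d i j)))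

  det-transpose : ∀ {n} (M : Matrix n) → det (flip M) ≈ det M
  det-transpose {zero}  M = refl
  det-transpose {suc n} M = trans
    (sum-cong λ j → *-congˡ {x = [-1]^ toℕ j} (*-congˡ {x = M j zero} (det-transpose (minor M j zero))))
    (sym (det-column₀ M))

  -- Vanishing determinants.

  det₂ : ∀ (M : Matrix 2) → det M ≈
    M zero zero * M (suc zero) (suc zero) ⊕ - (M zero (suc zero) * M (suc zero) zero)
  det₂ M = +-cong
    (trans (*-congˡ (*-congˡ (+-identityʳ _)))
      (solve 2 (λ a d → 𝟙 ⊗ (a ⊗ (𝟙 ⊗ (d ⊗ 𝟙))) ⊜ a ⊗ d) refl _ _))
    (trans (+-identityʳ _) (trans (*-congˡ (*-congˡ (+-identityʳ _)))
      (trans (solve 3 (λ x b c → (x ⊗ 𝟙) ⊗ (b ⊗ (𝟙 ⊗ (c ⊗ 𝟙))) ⊜ x ⊗ (b ⊗ c)) refl _ _ _)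
        (-1*x≈-x _))))

  -- The ring may have 2 as a zero divisor, so `det M ≈ - det M` would not suffice. Expansion along
  -- a third row instead leads to minors that still contain both equal rows, down to the explicit
  -- formula in size two.
  det-equalRows : ∀ {n} (M : Matrix n) {p q} → p ≢ q → (∀ j → M p j ≈ M q j) → det M ≈ 0#
  det-equalRows {suc zero} M {zero} {zero} p≢q Mp≈Mq = contradiction ≡.refl p≢q
  det-equalRows {suc (suc zero)} M {zero} {zero} p≢q Mp≈Mq = contradiction ≡.refl p≢q
  det-equalRows {suc (suc zero)} M {suc zero} {suc zero} p≢q Mp≈Mq = contradiction ≡.refl p≢q
  det-equalRows {suc (suc zero)} M {suc zero} {zero} p≢q Mp≈Mq =
    det-equalRows M {zero} {suc zero} (p≢q ∘ ≡.sym) (sym ∘ Mp≈Mq)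
  det-equalRows {suc (suc zero)} M {zero} {suc zero} p≢q Mp≈Mq = begin
    det M ≈⟨ det₂ M ⟩
    M zero zero * M (suc zero) (suc zero) ⊕ - (M zero (suc zero) * M (suc zero) zero)
      ≈⟨ +-cong (*-congʳ (Mp≈Mq zero)) (-‿cong (trans (*-congʳ (Mp≈Mq (suc zero))) (*-comm _ _))) ⟩
    M (suc zero) zero * M (suc zero) (suc zero) ⊕ - (M (suc zero) zero * M (suc zero) (suc zero))
      ≈⟨ -‿inverseʳ _ ⟩
    0# ∎
  det-equalRows {suc (suc (suc n))} M {p} {q} p≢q Mp≈Mq = trans (det-row M r) (sum-zero λ j → begin
    M r j * cofactor M r j ≈⟨ *-congˡ (*-congˡ (det-equalRows (minor M r j) p′≢q′ (rows j))) ⟩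
    M r j * ([-1]^ (toℕ r + toℕ j) * 0#) ≈⟨ *-congˡ (zeroʳ _) ⟩
    M r j * 0# ≈⟨ zeroʳ _ ⟩
    0# ∎)
    where
    r = proj₁ (third p q)
    r≢p = proj₁ (proj₂ (third p q))
    r≢q = proj₂ (proj₂ (third p q))
    p′ = punchOut r≢p
    q′ = punchOut r≢q
    p′≢q′ : p′ ≢ q′
    p′≢q′ eq = p≢q (≡.trans (≡.sym (punchIn-punchOut r≢p))
      (≡.trans (≡.cong (punchIn r) eq) (punchIn-punchOut r≢q)))
    rows : ∀ j k → minor M r j p′ k ≈ minor M r j q′ k
    rows j k = begin
      M (punchIn r p′) (punchIn j k) ≡⟨ ≡.cong (flip M _) (punchIn-punchOut r≢p) ⟩
      M p (punchIn j k)              ≈⟨ Mp≈Mq _ ⟩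
      M q (punchIn j k)              ≡⟨ ≡.cong (flip M _) (punchIn-punchOut r≢q) ⟨
      M (punchIn r q′) (punchIn j k) ∎

  -- Adding all the other rows to the first one makes it vanish.
  det-columnSums≈0 : ∀ {n} (M : Matrix (suc n)) → (∀ j → (sum λ i → M i j) ≈ 0#) → det M ≈ 0#
  det-columnSums≈0 M sums≈0 = begin
    det M
      ≈⟨ +-identityʳ (det M) ⟨
    det M ⊕ 0#
      ≈⟨ +-cong (det-row M zero) (sym (sum-zero rest≈0)) ⟩
    (sum λ r → sum λ j → M r j * cofactor M zero j)
      ≈⟨ ∑-comm (λ r j → M r j * cofactor M zero j) ⟩
    (sum λ j → sum λ r → M r j * cofactor M zero j)
      ≈⟨ sum-cong (λ j → *-distribʳ-sum (cofactor M zero j) (λ r → M r j)) ⟨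
    (sum λ j → (sum λ r → M r j) * cofactor M zero j)
      ≈⟨ sum-zero (λ j → trans (*-congʳ (sums≈0 j)) (zeroˡ (cofactor M zero j))) ⟩
    0# ∎
    where
    rest≈0 : ∀ r → (sum λ j → M (suc r) j * cofactor M zero j) ≈ 0#
    rest≈0 r = trans (sym (det-row N zero)) (det-equalRows N {zero} {suc r} 0≢1+n λ _ → refl)
      where
      N : Matrix _
      N zero    = M (suc r)
      N (suc i) = M (suc i)

  det-rowSums≈0 : ∀ {n} (M : Matrix (suc n)) → (∀ i → sum (M i) ≈ 0#) → det M ≈ 0#
  det-rowSums≈0 M sums≈0 = trans (sym (det-transpose M)) (det-columnSums≈0 (flip M) sums≈0)

  -- Kronecker delta and incidence vectors.

  δ : ∀ {n} → Fin n → Fin n → Carrier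
  δ zero    zero    = 1#
  δ zero    (suc j) = 0#
  δ (suc i) zero    = 0#
  δ (suc i) (suc j) = δ i j

  δ-refl : ∀ {n} (i : Fin n) → δ i i ≈ 1#
  δ-refl zero    = refl
  δ-refl (suc i) = δ-refl i

  δ-≢ : ∀ {n} {i j : Fin n} → i ≢ j → δ i j ≈ 0#
  δ-≢ {i = zero}  {zero}  i≢j = contradiction ≡.refl i≢j
  δ-≢ {i = zero}  {suc j} i≢j = refl
  δ-≢ {i = suc i} {zero}  i≢j = refl
  δ-≢ {i = suc i} {suc j} i≢j = δ-≢ (i≢j ∘ ≡.cong suc)

  δ-punchIn : ∀ {n} (p : Fin (suc n)) i j → δ (punchIn p i) (punchIn p j) ≈ δ i j
  δ-punchIn zero    i       j       = refl
  δ-punchIn (suc p) zero    zero    = refl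
  δ-punchIn (suc p) zero    (suc j) = refl
  δ-punchIn (suc p) (suc i) zero    = refl
  δ-punchIn (suc p) (suc i) (suc j) = δ-punchIn p i j

  sum-δ : ∀ {n} (i : Fin n) (f : Fin n → Carrier) → (sum λ j → δ i j * f j) ≈ f i
  sum-δ zero    f = trans
    (+-cong (*-identityˡ _) (sum-zero λ j → zeroˡ (f (suc j)))) (+-identityʳ _)
  sum-δ (suc i) f = trans (+-cong (zeroˡ _) (sum-δ i (f ∘ suc))) (+-identityˡ _)

  incidence : ∀ {n} → Fin n → Fin n → Fin n → Carrier
  incidence a b i = δ a i ⊕ - δ b i

  sum-incidence : ∀ {n} (a b : Fin n) (f : Fin n → Carrier) →
    (sum λ j → incidence a b j * f j) ≈ f a ⊕ - f b
  sum-incidence a b f = begin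
    (sum λ j → incidence a b j * f j)
      ≈⟨ sum-cong (λ j → trans (distribʳ (f j) (δ a j) (- δ b j))
           (+-congˡ (trans (sym (-‿distribˡ-* (δ b j) (f j))) (-‿distribʳ-* (δ b j) (f j))))) ⟩
    (sum λ j → δ a j * f j ⊕ δ b j * - f j)
      ≈⟨ ∑-distrib-+ (λ j → δ a j * f j) (λ j → δ b j * - f j) ⟩
    (sum λ j → δ a j * f j) ⊕ (sum λ j → δ b j * - f j)
      ≈⟨ +-cong (sum-δ a f) (sum-δ b (λ j → - f j)) ⟩
    f a ⊕ - f b ∎

  sum-incidence≈0 : ∀ {n} (a b : Fin n) → sum (incidence a b) ≈ 0#
  sum-incidence≈0 a b = begin
    sum (incidence a b)                ≈⟨ sum-cong (λ j → *-identityʳ (incidence a b j)) ⟨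
    (sum λ j → incidence a b j * 1#)   ≈⟨ sum-incidence a b (λ _ → 1#) ⟩
    1# ⊕ - 1#                          ≈⟨ -‿inverseʳ 1# ⟩
    0#                                 ∎

  -- Cofactors of Laplace-like matrices.

  replaceRow : ∀ {n} → Matrix n → Fin n → (Fin n → Carrier) → Matrix n
  replaceRow M i v = updateAt M i (const v)

  det-replaceRow : ∀ {n} (M : Matrix (suc n)) i v →
    det (replaceRow M i v) ≈ sum λ j → v j * cofactor M i j
  det-replaceRow M i v = trans (det-row (replaceRow M i v) i) (sum-cong λ j → *-cong
    (reflexive (≡.cong (λ r → r j) (updateAt-updates i {const v} M)))
    (cofactor-cong i j λ k l k≢i _ →
      reflexive (≡.cong (λ r → r l) (updateAt-minimal k i {const v} M k≢i))))

  -- The difference of the two cofactors is the determinant of `M` with row `i` replaced by an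
  -- incidence vector. All rows of that matrix still sum to zero, so it is singular.
  cofactor-sameRow : ∀ {n} (M : Matrix (suc n)) → (∀ i → sum (M i) ≈ 0#) →
    ∀ i p q → cofactor M i p ≈ cofactor M i q
  cofactor-sameRow M sums≈0 i p q = x∙y⁻¹≈ε⇒x≈y _ _ (begin
    cofactor M i p ⊕ - cofactor M i q           ≈⟨ sum-incidence p q (cofactor M i) ⟨
    (sum λ j → incidence p q j * cofactor M i j) ≈⟨ det-replaceRow M i (incidence p q) ⟨
    det N                                        ≈⟨ det-rowSums≈0 N sums′≈0 ⟩
    0#                                           ∎)
    where
    N = replaceRow M i (incidence p q)
    sums′≈0 : ∀ k → sum (N k) ≈ 0#
    sums′≈0 k with k ≟ i
    ... | yes ≡.refl = trans (reflexive (≡.cong sum (updateAt-updates i M))) (sum-incidence≈0 p q)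
    ... | no  k≢i    = trans (reflexive (≡.cong sum (updateAt-minimal k i M k≢i))) (sums≈0 k)

  cofactor-transpose : ∀ {n} (M : Matrix (suc n)) i j → cofactor (flip M) i j ≈ cofactor M j i
  cofactor-transpose M i j = *-cong
    (reflexive (≡.cong [-1]^_ (ℕ.+-comm (toℕ i) (toℕ j)))) (det-transpose (minor M j i))

  -- Zero row sums allow the column index to move; symmetry turns rows into columns, so the row
  -- index can move as well.
  cofactor-constant : ∀ {n} {M : Matrix (suc n)} → LaplaceLike M →
    ∀ i j k l → cofactor M i j ≈ cofactor M k l
  cofactor-constant {M = M} M-laplace i j k l = begin
    cofactor M i j        ≈⟨ cofactor-sameRow M rowSum≈0 i j k ⟩
    cofactor M i k        ≈⟨ cofactor-cong i k (λ x y _ _ → symmetric x y) ⟩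
    cofactor (flip M) i k ≈⟨ cofactor-transpose M i k ⟩
    cofactor M k i        ≈⟨ cofactor-sameRow M rowSum≈0 k i l ⟩
    cofactor M k l        ∎
    where open LaplaceLike M-laplace

  [-1]^-double : ∀ k → [-1]^ (k + k) ≈ 1#
  [-1]^-double zero    = refl
  [-1]^-double (suc k) = begin
    - 1# * [-1]^ (k + suc k)        ≡⟨ ≡.cong (λ l → - 1# * [-1]^ l) (ℕ.+-suc k k) ⟩
    - 1# * (- 1# * [-1]^ (k + k))   ≈⟨ *-assoc _ _ _ ⟨
    (- 1# * - 1#) * [-1]^ (k + k)   ≈⟨ *-cong -1*-1≈1 ([-1]^-double k) ⟩
    1# * 1#                         ≈⟨ *-identityˡ 1# ⟩
    1#                              ∎

  cofactor-diagonal : ∀ {n} (M : Matrix (suc n)) i → cofactor M i i ≈ det (minor M i i)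
  cofactor-diagonal M i = trans (*-congʳ ([-1]^-double (toℕ i))) (*-identityˡ _)

  principalMinor-constant : ∀ {n} {M : Matrix (suc n)} → LaplaceLike M →
    ∀ i j → det (minor M i i) ≈ det (minor M j j)
  principalMinor-constant {M = M} M-laplace i j = begin
    det (minor M i i) ≈⟨ cofactor-diagonal M i ⟨
    cofactor M i i    ≈⟨ cofactor-constant M-laplace i i j j ⟩
    cofactor M j j    ≈⟨ cofactor-diagonal M j ⟩
    det (minor M j j) ∎

  -- Only the entry at `(b , b)` changes, so the cofactors along row `b` are those of `M`, and
  -- expansion along that row isolates the change.
  det-perturb : ∀ {n} {M N : Matrix (suc n)} b w →
    (∀ i j → N i j ≈ M i j ⊕ - (w * (δ b i * δ b j))) →
    det N ≈ det M ⊕ - (w * det (minor M b b))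
  det-perturb {M = M} {N} b w N≈ = begin
    det N
      ≈⟨ det-row N b ⟩
    (sum λ j → N b j * cofactor N b j)
      ≈⟨ sum-cong (λ j → *-cong (row j) (cofactor-cong b j λ k l k≢b _ → offRow k l k≢b)) ⟩
    (sum λ j → (M b j ⊕ δ b j * - w) * cofactor M b j)
      ≈⟨ sum-cong (λ j → trans (distribʳ (cofactor M b j) (M b j) (δ b j * - w))
           (+-congˡ (*-assoc (δ b j) (- w) (cofactor M b j)))) ⟩
    (sum λ j → M b j * cofactor M b j ⊕ δ b j * (- w * cofactor M b j))
      ≈⟨ ∑-distrib-+ (λ j → M b j * cofactor M b j) (λ j → δ b j * (- w * cofactor M b j)) ⟩
    (sum λ j → M b j * cofactor M b j) ⊕ (sum λ j → δ b j * (- w * cofactor M b j))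
      ≈⟨ +-cong (sym (det-row M b)) (sum-δ b λ j → - w * cofactor M b j) ⟩
    det M ⊕ - w * cofactor M b b
      ≈⟨ +-congˡ (trans (*-congˡ (cofactor-diagonal M b)) (sym (-‿distribˡ-* _ _))) ⟩
    det M ⊕ - (w * det (minor M b b)) ∎
    where
    row : ∀ j → N b j ≈ M b j ⊕ δ b j * - w
    row j = trans (N≈ b j) (+-congˡ (begin
      - (w * (δ b b * δ b j)) ≈⟨ -‿cong (*-congˡ (trans (*-congʳ (δ-refl b)) (*-identityˡ _))) ⟩
      - (w * δ b j)           ≈⟨ -‿cong (*-comm _ _) ⟩
      - (δ b j * w)           ≈⟨ -‿distribʳ-* _ _ ⟩
      δ b j * - w             ∎))
    offRow : ∀ k l → k ≢ b → N k l ≈ M k l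
    offRow k l k≢b = trans (N≈ k l) (trans (+-congˡ (begin
      - (w * (δ b k * δ b l)) ≈⟨ -‿cong (*-congˡ (trans (*-congʳ (δ-≢ (≢-sym k≢b))) (zeroˡ _))) ⟩
      - (w * 0#)              ≈⟨ -‿cong (zeroʳ w) ⟩
      - 0#                    ≈⟨ -0#≈0# ⟩
      0#                      ∎)) (+-identityʳ _))

-- Forests and their components

Adj-mono : ∀ {n} {E F : EdgeSet n} {i j} → E ⊆ F → Adj E i j → Adj F i j
Adj-mono E⊆F = Sum.map E⊆F E⊆F

Connected-mono : ∀ {n} {E F : EdgeSet n} → E ⊆ F → Connected E → Connected F
Connected-mono E⊆F conn i j = Star.map (Adj-mono E⊆F) (conn i j)

Acyclic-anti : ∀ {n} {E F : EdgeSet n} → E ⊆ F → Acyclic F → Acyclic E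
Acyclic-anti E⊆F acyclic x xs (long , unique , linked) =
  acyclic x xs (long , unique , Linked.map (Adj-mono E⊆F) linked)

Star-sym : ∀ {n} {E : EdgeSet n} {i j} → Star (Adj E) i j → Star (Adj E) j i
Star-sym = Star.reverse Sum.swap

linked⇒star : ∀ {n} {E : EdgeSet n} {u l} us → Linked (Adj E) (u ∷ (us ∷ʳ l)) → Star (Adj E) u l
linked⇒star []       (e ∷ _)  = e ◅ ε
linked⇒star (v ∷ vs) (e ∷ es) = e ◅ linked⇒star vs es

Unique-rotate : ∀ {n} {x : Fin n} {ys} → Unique (x ∷ ys) → Unique (ys ∷ʳ x)
Unique-rotate (x∉ys ∷ unique) =
  AllPairs.++⁺ unique ([] ∷ []) (All.map (λ x≢y → ≢-sym x≢y ∷ []) x∉ys)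

-- Adding an edge between two components.

module _ {n} {a b : Fin n} {F : EdgeSet n} where

  Crossing : Fin n → Fin n → Set
  Crossing u l = (Star (Adj F) u a × Star (Adj F) b l) ⊎ (Star (Adj F) u b × Star (Adj F) a l)

  crossing-◅ : ∀ {u v l} → Adj F u v → Crossing v l → Crossing u l
  crossing-◅ e = Sum.map (λ (p , q) → e ◅ p , q) (λ (p , q) → e ◅ p , q)

  adj-∷⁻ : ∀ {u v} → Adj ((a , b) ∷ F) u v → Adj F u v ⊎ (u ≡ a × v ≡ b) ⊎ (u ≡ b × v ≡ a)
  adj-∷⁻ (inj₁ (here ≡.refl)) = inj₂ (inj₁ (≡.refl , ≡.refl))
  adj-∷⁻ (inj₂ (here ≡.refl)) = inj₂ (inj₂ (≡.refl , ≡.refl))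
  adj-∷⁻ (inj₁ (there e))   = inj₁ (inj₁ e)
  adj-∷⁻ (inj₂ (there e))   = inj₁ (inj₂ e)

  -- A link along `(a , b)` visits both ends of that edge, which is impossible for a list that
  -- misses one of them.
  linked-avoiding : ∀ {x us} → x ≡ a ⊎ x ≡ b → All (x ≢_) us →
    Linked (Adj ((a , b) ∷ F)) us → Linked (Adj F) us
  linked-avoiding x≡ _                   []       = []
  linked-avoiding x≡ _                   [-]      = [-]
  linked-avoiding x≡ (x≢u ∷ x≢v ∷ x∉us) (e ∷ es) with adj-∷⁻ e | x≡
  ... | inj₁ e′                    | _         = e′ ∷ linked-avoiding x≡ (x≢v ∷ x∉us) es
  ... | inj₂ (inj₁ (≡.refl , ≡.refl)) | inj₁ ≡.refl = contradiction ≡.refl x≢u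
  ... | inj₂ (inj₁ (≡.refl , ≡.refl)) | inj₂ ≡.refl = contradiction ≡.refl x≢v
  ... | inj₂ (inj₂ (≡.refl , ≡.refl)) | inj₁ ≡.refl = contradiction ≡.refl x≢v
  ... | inj₂ (inj₂ (≡.refl , ≡.refl)) | inj₂ ≡.refl = contradiction ≡.refl x≢u

  -- A simple path uses the edge (a , b) at most once.
  cutPath : ∀ {u l} us → Unique (u ∷ (us ∷ʳ l)) → Linked (Adj ((a , b) ∷ F)) (u ∷ (us ∷ʳ l)) →
    Linked (Adj F) (u ∷ (us ∷ʳ l)) ⊎ Crossing u l
  cutPath [] _ (e ∷ [-]) with adj-∷⁻ e
  ... | inj₁ e′                   = inj₁ (e′ ∷ [-])
  ... | inj₂ (inj₁ (≡.refl , ≡.refl)) = inj₂ (inj₁ (ε , ε))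
  ... | inj₂ (inj₂ (≡.refl , ≡.refl)) = inj₂ (inj₂ (ε , ε))
  cutPath (v ∷ vs) (u∉ ∷ unique) (e ∷ es) with adj-∷⁻ e
  ... | inj₁ e′                   = Sum.map (e′ ∷_) (crossing-◅ e′) (cutPath vs unique es)
  ... | inj₂ (inj₁ (≡.refl , ≡.refl)) =
    inj₂ (inj₁ (ε , linked⇒star vs (linked-avoiding (inj₁ ≡.refl) u∉ es)))
  ... | inj₂ (inj₂ (≡.refl , ≡.refl)) =
    inj₂ (inj₂ (ε , linked⇒star vs (linked-avoiding (inj₂ ≡.refl) u∉ es)))

  ¬crossing : ∀ {u v} → ¬ Star (Adj F) a b → Adj F u v → ¬ Crossing v u
  ¬crossing a≁b e (inj₁ (p , q)) = a≁b (Star-sym (q ◅◅ e ◅ p))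
  ¬crossing a≁b e (inj₂ (p , q)) = a≁b (q ◅◅ e ◅ p)

  -- A simple path from one end of the edge (a , b) to the other, of length at least two.
  avoidEdge : ∀ {x y z zs} → x ≡ a ⊎ x ≡ b → y ≡ a ⊎ y ≡ b → Unique (x ∷ y ∷ z ∷ zs) →
    Linked (Adj ((a , b) ∷ F)) (y ∷ z ∷ (zs ∷ʳ x)) → Star (Adj F) y x
  avoidEdge {z = z} {zs} x≡ y≡ ((x≢y ∷ x≢z ∷ _) ∷ y∉zs ∷ _) (e ∷ es) =
    linked⇒star (z ∷ zs)
      (Linked.head (linked-avoiding x≡ (x≢y ∷ x≢z ∷ []) (e ∷ [-]))
      ∷ linked-avoiding y≡ (All.++⁺ y∉zs (≢-sym x≢y ∷ [])) es)

  -- If the first link of a cycle lies in `F`, the rest is a simple path from `y` back to `x`: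
  -- either it lies in `F`, which gives a cycle of `F`, or it crosses `(a , b)` once, and then its
  -- two pieces and the first link join `a` to `b` in `F`. If the first link is the new edge, the
  -- rest of the cycle joins its ends in `F`.
  acyclic-∷ : Acyclic F → ¬ Star (Adj F) a b → Acyclic ((a , b) ∷ F)
  acyclic-∷ acyclic a≁b x (y ∷ []) (s≤s () , _)
  acyclic-∷ acyclic a≁b x (y ∷ z ∷ zs) (long , unique , e ∷ path) with adj-∷⁻ e
  ... | inj₁ e′ =
    [ (λ linked → acyclic x (y ∷ z ∷ zs) (long , unique , e′ ∷ linked)) , ¬crossing a≁b e′ ]
    (cutPath (z ∷ zs) (Unique-rotate unique) path)
  ... | inj₂ (inj₁ (≡.refl , ≡.refl)) =
    a≁b (Star-sym (avoidEdge (inj₁ ≡.refl) (inj₂ ≡.refl) unique path))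
  ... | inj₂ (inj₂ (≡.refl , ≡.refl)) =
    a≁b (avoidEdge (inj₂ ≡.refl) (inj₁ ≡.refl) unique path)

-- Adding an edge inside a component.

module _ {n} {F : EdgeSet n} where

  open DecMembership (_≟_ {n}) using (_∈?_)

  -- The endpoint `b` comes first in the uniqueness condition and last in the chain, as in
  -- `IsCycle`, so that prepending a link from `b` to `c` closes the path into a cycle.
  SimplePath : Fin n → Fin n → Set
  SimplePath c b = ∃ λ xs → Unique (b ∷ c ∷ xs) × Linked (Adj F) (c ∷ (xs ∷ʳ b))

  -- Loop erasure: when a new starting vertex already lies on the path, everything before that
  -- occurrence is dropped.
  suffix : ∀ {b c ys} → c ∈ ys → Unique (b ∷ ys) → Linked (Adj F) (ys ∷ʳ b) → SimplePath c b
  suffix (here ≡.refl)               unique                      linked = _ , unique , linked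
  suffix (there c∈ys) ((_ ∷ b∉ys) ∷ _ ∷ unique) linked =
    suffix c∈ys (b∉ys ∷ unique) (Linked.tail linked)

  star⇒simplePath : ∀ {b c} → b ≢ c → Star (Adj F) c b → SimplePath c b
  star⇒simplePath b≢c ε = contradiction ≡.refl b≢c
  star⇒simplePath {b} {c} b≢c (_◅_ {j = d} e p) with b ≟ d
  ... | yes ≡.refl = [] , (b≢c ∷ []) ∷ [] ∷ [] , e ∷ [-]
  ... | no b≢d with star⇒simplePath b≢d p
  ...   | xs , unique@(b∉ ∷ d∉xs) , linked with c ∈? d ∷ xs
  ...     | yes c∈ = suffix c∈ unique linked
  ...     | no c∉  = d ∷ xs , (b≢c ∷ b∉) ∷ All.¬Any⇒All¬ _ c∉ ∷ d∉xs , e ∷ linked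

  -- The new edge closes a simple path of `F` into a cycle. Since `a` and `b` are not adjacent in
  -- `F`, the path has an inner vertex, so the cycle reaches the three vertices that `IsCycle`
  -- demands.
  ¬acyclic-∷ : ∀ {a b} → b ≢ a → ¬ Adj F a b → Star (Adj F) a b → ¬ Acyclic ((a , b) ∷ F)
  ¬acyclic-∷ {a} {b} b≢a a≁b p acyclic with star⇒simplePath b≢a p
  ... | []     , _      , e ∷ _  = a≁b e
  ... | x ∷ xs , unique , linked = acyclic b (a ∷ x ∷ xs)
    (s≤s (s≤s z≤n) , unique , inj₂ (here ≡.refl) ∷ Linked.map (Adj-mono there) linked)

-- Identification of two components.

-- The number `α` is the one given up, so the new numbering agrees with that of the rows left after
-- deleting row `α`.
merge : ∀ {k} {α β : Fin (suc k)} → α ≢ β → Fin (suc k) → Fin k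
merge {α = α} α≢β i with α ≟ i
... | yes _   = punchOut α≢β
... | no  α≢i = punchOut α≢i

merge-punchIn : ∀ {k} {α β : Fin (suc k)} (α≢β : α ≢ β) x → merge α≢β (punchIn α x) ≡ x
merge-punchIn {α = α} α≢β x with α ≟ punchIn α x
... | yes α≡ = contradiction (≡.sym α≡) (punchInᵢ≢i α x)
... | no  _  = ≡.trans (punchOut-cong α ≡.refl) (punchOut-punchIn α)

module _ {k} {α β : Fin (suc k)} (α≢β : α ≢ β) where

  -- The three alternatives match those of `Through`, which is how `components-∷` uses them.
  merge-≡⁻ : ∀ i j → merge α≢β i ≡ merge α≢β j → i ≡ j ⊎ (i ≡ α × β ≡ j) ⊎ (i ≡ β × α ≡ j)
  merge-≡⁻ i j eq with α ≟ i | α ≟ j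
  ... | yes ≡.refl | yes ≡.refl = inj₁ ≡.refl
  ... | yes ≡.refl | no  α≢j  = inj₂ (inj₁ (≡.refl , punchOut-injective α≢β α≢j eq))
  ... | no  α≢i  | yes ≡.refl = inj₂ (inj₂ (punchOut-injective α≢i α≢β eq , ≡.refl))
  ... | no  α≢i  | no  α≢j  = inj₁ (punchOut-injective α≢i α≢j eq)

  merge-α≡β : merge α≢β α ≡ merge α≢β β
  merge-α≡β with α ≟ α | α ≟ β
  ... | _       | yes α≡β = contradiction α≡β α≢β
  ... | no  α≢α | no _    = contradiction ≡.refl α≢α
  ... | yes _   | no _    = punchOut-cong α ≡.refl

-- `F` is a forest and `π` numbers its components; `surjective` makes `k` their exact number.
record Components {n k} (F : EdgeSet n) (π : Fin n → Fin k) : Set where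
  field
    acyclic    : Acyclic F
    sound      : ∀ {i j} → π i ≡ π j → Star (Adj F) i j
    complete   : ∀ {i j} → Star (Adj F) i j → π i ≡ π j
    surjective : ∀ y → ∃ λ x → π x ≡ y

components-[] : ∀ {n} → Components {n} [] id
components-[] = record
  { acyclic    = λ { x (y ∷ _) (_ , _ , inj₁ () ∷ _) ; x (y ∷ _) (_ , _ , inj₂ () ∷ _) }
  ; sound      = λ { ≡.refl → ε }
  ; complete   = λ { ε → ≡.refl ; (inj₁ () ◅ _) ; (inj₂ () ◅ _) }
  ; surjective = λ y → y , ≡.refl
  }

components-∷ : ∀ {n k} {F : EdgeSet n} {π : Fin n → Fin (suc k)} {a b} (πa≢πb : π a ≢ π b) →
  Components F π → Components ((a , b) ∷ F) (merge πa≢πb ∘ π)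
components-∷ {F = F} {π} {a} {b} πa≢πb C = record
  { acyclic    = acyclic-∷ acyclic (πa≢πb ∘ complete)
  ; sound      = fromThrough a b F ∘ Sum.map sound
                   (Sum.map (λ (p , q) → sound p , sound q) (λ (p , q) → sound p , sound q))
                 ∘ merge-≡⁻ πa≢πb _ _
  ; complete   = complete′ ∘ toThrough a b F
  ; surjective = λ y → let x , πx≡ = surjective (punchIn (π a) y) in
                   x , ≡.trans (≡.cong (merge πa≢πb) πx≡) (merge-punchIn πa≢πb y)
  }
  where
  open Components C
  m = merge πa≢πb
  complete′ : ∀ {i j} → Through a b F i j → m (π i) ≡ m (π j)
  complete′ (inj₁ p) = ≡.cong m (complete p)
  complete′ (inj₂ (inj₁ (p , q))) =
    ≡.trans (≡.cong m (complete p)) (≡.trans (merge-α≡β πa≢πb) (≡.cong m (complete q)))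
  complete′ (inj₂ (inj₂ (p , q))) =
    ≡.trans (≡.cong m (complete p)) (≡.trans (≡.sym (merge-α≡β πa≢πb)) (≡.cong m (complete q)))

-- Deletion and contraction

-- The edges E still to be examined when those of F have been selected.
record Fresh {n} (F E : EdgeSet n) : Set where
  field
    ordered  : All (λ (a , b) → a < b) E
    unique   : Unique E
    unlinked : All (λ (a , b) → ¬ Adj F a b) E

fresh-skip : ∀ {n} {F E : EdgeSet n} {e} → Fresh F (e ∷ E) → Fresh F E
fresh-skip record { ordered = _ ∷ o ; unique = _ ∷ u ; unlinked = _ ∷ l } =
  record { ordered = o ; unique = u ; unlinked = l }

-- A later edge with the same ends as the selected one would either equal it, against uniqueness, or
-- be its reverse, against the ordering.
fresh-select : ∀ {n} {F E : EdgeSet n} {e} → Fresh F (e ∷ E) → Fresh (e ∷ F) E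
fresh-select {F = F} {E} {a , b} record { ordered = a<b ∷ o ; unique = e∉E ∷ u ; unlinked = _ ∷ l } =
  record { ordered = o ; unique = u ; unlinked = All.zipWith unlink (All.zip (o , e∉E) , l) }
  where
  unlink : ∀ {e} → ((proj₁ e < proj₂ e) × (a , b) ≢ e) × ¬ Adj F (proj₁ e) (proj₂ e) →
    ¬ Adj ((a , b) ∷ F) (proj₁ e) (proj₂ e)
  unlink ((c<d , e≢) , ¬adj) adj with adj-∷⁻ adj
  ... | inj₁ adj′                   = ¬adj adj′
  ... | inj₂ (inj₁ (≡.refl , ≡.refl)) = e≢ ≡.refl
  ... | inj₂ (inj₂ (≡.refl , ≡.refl)) = <-asym a<b c<d

fresh-pairs : ∀ n → Fresh [] (pairs n)
fresh-pairs n = record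
  { ordered  = All.all-filter (λ (i , j) → i <? j) (cartesianProduct (allFin n) (allFin n))
  ; unique   = Unique.filter⁺ (λ (i , j) → i <? j)
                 (Unique.cartesianProduct⁺ (Unique.allFin⁺ n) (Unique.allFin⁺ n))
  ; unlinked = All.universal (λ { _ (inj₁ ()) ; _ (inj₂ ()) }) _
  }

∈-pairs : ∀ {n} {i j : Fin n} → i < j → (i , j) ∈ pairs n
∈-pairs = ∈-filter⁺ (λ (i , j) → i <? j) (∈-cartesianProduct⁺ (∈-allFin _) (∈-allFin _))

module MatrixTree {c ℓ} (R : CommutativeRing c ℓ) where

  open CommutativeRing R hiding (zero) renaming (_+_ to _⊕_)
  open Matrices R
  open Determinant R
  open RingProperties ring
  open SemiringSum semiring
  open CommutativeSemigroupProperties *-commutativeSemigroup using (x∙yz≈y∙xz)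
  open import Relation.Binary.Reasoning.Setoid setoid

  -- Laplacians of contracted graphs.

  module _ {n} (L : Matrix n) where

    -- L restricted to the edges E, contracted along π : the matrix
    -- − Σ L_ab v vᵀ over (a , b) in E, where v is the incidence vector of (π a , π b).
    laplacian : ∀ {k} → EdgeSet n → (Fin n → Fin k) → Matrix k
    laplacian []            π i j = 0#
    laplacian ((a , b) ∷ E) π i j =
      laplacian E π i j ⊕ - (L a b * (incidence (π a) (π b) i * incidence (π a) (π b) j))

    laplacian-symmetric : ∀ {k} E (π : Fin n → Fin k) i j → laplacian E π i j ≈ laplacian E π j i
    laplacian-symmetric []            π i j = refl
    laplacian-symmetric ((a , b) ∷ E) π i j =
      +-cong (laplacian-symmetric E π i j) (-‿cong (*-congˡ (*-comm _ _)))

    laplacian-rowSum≈0 : ∀ {k} E (π : Fin n → Fin k) i → sum (laplacian E π i) ≈ 0#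
    laplacian-rowSum≈0 {k} []        π i = sum-replicate-zero k
    laplacian-rowSum≈0 ((a , b) ∷ E) π i = begin
      sum (laplacian ((a , b) ∷ E) π i)
        ≈⟨ ∑-distrib-+ (laplacian E π i) (λ j → - (L a b * (v i * v j))) ⟩
      sum (laplacian E π i) ⊕ (sum λ j → - (L a b * (v i * v j)))
        ≈⟨ +-cong (laplacian-rowSum≈0 E π i) (sum-cong λ j →
             trans (-‿cong (sym (*-assoc (L a b) (v i) (v j)))) (-‿distribˡ-* (L a b * v i) (v j))) ⟩
      0# ⊕ (sum λ j → - (L a b * v i) * v j)
        ≈⟨ +-identityˡ _ ⟩
      (sum λ j → - (L a b * v i) * v j)
        ≈⟨ *-distribˡ-sum (- (L a b * v i)) v ⟨
      - (L a b * v i) * sum v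
        ≈⟨ *-congˡ (sum-incidence≈0 (π a) (π b)) ⟩
      - (L a b * v i) * 0#
        ≈⟨ zeroʳ _ ⟩
      0# ∎
      where v = incidence (π a) (π b)

    laplacian-laplaceLike : ∀ {k} E (π : Fin n → Fin k) → LaplaceLike (laplacian E π)
    laplacian-laplaceLike E π = record
      { symmetric = laplacian-symmetric E π
      ; rowSum≈0  = laplacian-rowSum≈0 E π
      }

    laplacian-loop : ∀ {k} {π : Fin n → Fin k} {a b} E → π a ≡ π b → ∀ i j →
      laplacian ((a , b) ∷ E) π i j ≈ laplacian E π i j
    laplacian-loop {π = π} {a} {b} E πa≡πb i j = trans (+-congˡ (begin
      - (L a b * (incidence (π a) (π b) i * incidence (π a) (π b) j))
        ≈⟨ -‿cong (*-congˡ (*-congʳ (trans (+-congʳ (reflexive (≡.cong (λ p → δ p i) πa≡πb)))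
             (-‿inverseʳ _)))) ⟩
      - (L a b * (0# * incidence (π a) (π b) j))
        ≈⟨ -‿cong (trans (*-congˡ (zeroˡ _)) (zeroʳ _)) ⟩
      - 0#
        ≈⟨ -0#≈0# ⟩
      0# ∎)) (+-identityʳ _)

    -- The second index on the right differs from both `α` and `β`, and away from these merging only
    -- renumbers.
    δ-merge : ∀ {k} {α β : Fin (suc (suc k))} (α≢β : α ≢ β) p x →
      δ (merge α≢β p) (punchIn (punchOut α≢β) x) ≈ δ p (punchIn α (punchIn (punchOut α≢β) x))
    δ-merge {α = α} α≢β p x with α ≟ p
    ... | yes ≡.refl = trans (δ-≢ (punchInᵢ≢i (punchOut α≢β) x ∘ ≡.sym)) (sym (δ-≢ (punchInᵢ≢i α _ ∘ ≡.sym)))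
    ... | no  α≢p    = trans (sym (δ-punchIn α _ _))
      (reflexive (≡.cong (λ q → δ q (punchIn α (punchIn _ x))) (punchIn-punchOut α≢p)))

    -- Contraction alters only the rows and columns of the two merged components, and these are
    -- deleted on both sides.
    laplacian-merge : ∀ {k} {α β : Fin (suc (suc k))} (α≢β : α ≢ β) E π → let β′ = punchOut α≢β in
      ∀ i j → minor (laplacian E (merge α≢β ∘ π)) β′ β′ i j
            ≈ minor (minor (laplacian E π) α α) β′ β′ i j
    laplacian-merge α≢β []            π i j = refl
    laplacian-merge α≢β ((a , b) ∷ E) π i j =
      +-cong (laplacian-merge α≢β E π i j) (-‿cong (*-congˡ (*-cong (inc i) (inc j))))
      where
      inc : ∀ i → incidence (merge α≢β (π a)) (merge α≢β (π b)) (punchIn (punchOut α≢β) i)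
        ≈ incidence (π a) (π b) (punchIn _ (punchIn (punchOut α≢β) i))
      inc i = +-cong (δ-merge α≢β (π a) i) (-‿cong (δ-merge α≢β (π b) i))

    -- Deleting the row and column of one end of the new edge leaves a
    -- perturbation of a single diagonal entry.
    det-laplacian-∷ : ∀ {k} {π : Fin n → Fin (suc (suc k))} {a b} (πa≢πb : π a ≢ π b) E →
      det (minor (laplacian ((a , b) ∷ E) π) zero zero)
      ≈ det (minor (laplacian E π) zero zero)
        ⊕ - (L a b * det (minor (laplacian E (merge πa≢πb ∘ π)) zero zero))
    det-laplacian-∷ {π = π} {a} {b} πa≢πb E = begin
      det (minor (laplacian ((a , b) ∷ E) π) zero zero)
        ≈⟨ principalMinor-constant (laplacian-laplaceLike ((a , b) ∷ E) π) zero α ⟩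
      det (minor (laplacian ((a , b) ∷ E) π) α α)
        ≈⟨ det-perturb {M = M} β′ (L a b) (λ i j →
             +-congˡ (-‿cong (*-congˡ (trans (*-cong (inc i) (inc j)) (-x*-y≈x*y (δ β′ i) (δ β′ j)))))) ⟩
      det M ⊕ - (L a b * det (minor M β′ β′))
        ≈⟨ +-cong (principalMinor-constant (laplacian-laplaceLike E π) α zero)
             (-‿cong (*-congˡ (trans (sym (det-cong (laplacian-merge πa≢πb E π)))
               (principalMinor-constant (laplacian-laplaceLike E (merge πa≢πb ∘ π)) β′ zero)))) ⟩
      _ ∎
      where
      α  = π a
      β′ = punchOut πa≢πb
      M  = minor (laplacian E π) α α
      -x*-y≈x*y : ∀ x y → - x * - y ≈ x * y
      -x*-y≈x*y x y = trans (sym (-‿distribˡ-* x (- y)))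
        (trans (-‿cong (sym (-‿distribʳ-* x y))) (-‿involutive _))
      inc : ∀ i → incidence (π a) (π b) (punchIn α i) ≈ - δ β′ i
      inc i = begin
        δ α (punchIn α i) ⊕ - δ (π b) (punchIn α i)
          ≈⟨ +-cong (δ-≢ (punchInᵢ≢i α i ∘ ≡.sym))
               (-‿cong (reflexive (≡.cong (λ q → δ q (punchIn α i)) (≡.sym (punchIn-punchOut πa≢πb))))) ⟩
        0# ⊕ - δ (punchIn α β′) (punchIn α i)
          ≈⟨ +-identityˡ _ ⟩
        - δ (punchIn α β′) (punchIn α i)
          ≈⟨ -‿cong (δ-punchIn α β′ i) ⟩
        - δ β′ i ∎

    -- Weighted sums over trees.

    ∑ˡ : List (EdgeSet n) → Carrier
    ∑ˡ Es = foldr _⊕_ 0# (map (λ E → A[ E ] L) Es)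

    ∑ˡ-++ : ∀ Es Fs → ∑ˡ (Es ++ Fs) ≈ ∑ˡ Es ⊕ ∑ˡ Fs
    ∑ˡ-++ []       Fs = sym (+-identityˡ _)
    ∑ˡ-++ (E ∷ Es) Fs = trans (+-congˡ (∑ˡ-++ Es Fs)) (sym (+-assoc _ _ _))

    ∑ˡ-filter-map-∷ : ∀ {p} {P : EdgeSet n → Set p} (P? : ∀ E → Dec (P E)) a b Es →
      ∑ˡ (filter P? (map ((a , b) ∷_) Es)) ≈ L a b * ∑ˡ (filter (λ E → P? ((a , b) ∷ E)) Es)
    ∑ˡ-filter-map-∷ P? a b []       = sym (zeroʳ _)
    ∑ˡ-filter-map-∷ P? a b (E ∷ Es) with does (P? ((a , b) ∷ E))
    ... | true  = trans (+-congˡ (∑ˡ-filter-map-∷ P? a b Es)) (sym (distribˡ _ _ _))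
    ... | false = ∑ˡ-filter-map-∷ P? a b Es

    -- The trees that arise from the selected edges F, listed in reverse,
    -- by adding some of the edges E; only the added edges are weighted.
    treeSum : EdgeSet n → EdgeSet n → Carrier
    treeSum F E = ∑ˡ (filter (λ S → isTree? (F ʳ++ S)) (sublists E))

    -- Splits the sublists by whether they contain `(a , b)`. Because `_ʳ++_` accumulates, moving
    -- that edge from the head of `S` to the head of `F` gives the same edge list by computation, so
    -- the tree conditions agree literally.
    treeSum-∷ : ∀ F a b E →
      treeSum F ((a , b) ∷ E) ≈ L a b * treeSum ((a , b) ∷ F) E ⊕ treeSum F E
    treeSum-∷ F a b E = begin
      treeSum F ((a , b) ∷ E)
        ≡⟨ ≡.cong ∑ˡ (List.filter-++ P? (map ((a , b) ∷_) (sublists E)) (sublists E)) ⟩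
      ∑ˡ (filter P? (map ((a , b) ∷_) (sublists E)) ++ filter P? (sublists E))
        ≈⟨ ∑ˡ-++ (filter P? (map ((a , b) ∷_) (sublists E))) _ ⟩
      ∑ˡ (filter P? (map ((a , b) ∷_) (sublists E))) ⊕ treeSum F E
        ≈⟨ +-congʳ (∑ˡ-filter-map-∷ P? a b (sublists E)) ⟩
      L a b * treeSum ((a , b) ∷ F) E ⊕ treeSum F E ∎
      where
      P? : ∀ S → Dec (IsTree (F ʳ++ S))
      P? S = isTree? (F ʳ++ S)

    treeSum-cyclic : ∀ F E → ¬ Acyclic F → treeSum F E ≈ 0#
    treeSum-cyclic F E cyclic = reflexive (≡.cong ∑ˡ (List.filter-none
      (λ S → isTree? (F ʳ++ S)) {sublists E}
      (All.universal (λ S (_ , acyclic) →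
        cyclic (Acyclic-anti (Any.reverseAcc⁺ S F ∘ inj₂) acyclic)) (sublists E))))

    treeSum-[]-tree : ∀ {F} → IsTree (F ʳ++ []) → treeSum F [] ≈ 1#
    treeSum-[]-tree {F} tree = trans (reflexive (≡.cong ∑ˡ
      (List.filter-accept (λ S → isTree? (F ʳ++ S)) {x = []} {xs = []} tree))) (+-identityʳ 1#)

    treeSum-[]-nontree : ∀ {F} → ¬ IsTree (F ʳ++ []) → treeSum F [] ≈ 0#
    treeSum-[]-nontree {F} ¬tree = reflexive (≡.cong ∑ˡ
      (List.filter-reject (λ S → isTree? (F ʳ++ S)) {x = []} {xs = []} ¬tree))

    -- Induction on `E`. A forest with `k + 1` components needs `k` more edges to become a tree, and
    -- each contraction brings one factor `- 1#`; hence the sign.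
    matrixTree : ∀ {k F} {π : Fin n → Fin (suc k)} E → Components F π → Fresh F E →
      det (minor (laplacian E π) zero zero) ≈ [-1]^ k * treeSum F E
    -- One component is left: the minor is empty, with determinant 1, and `F` itself is the only
    -- tree.
    matrixTree {zero} {F} [] C fresh = sym (trans (*-identityˡ _) (treeSum-[]-tree {F}
      ( Connected-mono (Any.reverse⁺ {xs = F}) (λ i j → sound (Fin1-≡ _ _))
      , Acyclic-anti (Any.reverse⁻ {xs = F}) acyclic)))
      where
      open Components C
      Fin1-≡ : ∀ (i j : Fin 1) → i ≡ j
      Fin1-≡ zero zero = ≡.refl
    -- At least two components remain and no edge can join them: the minor is a nonempty zero matrix
    -- and there is no tree.
    matrixTree {suc k} {F} [] C fresh = begin
      det {suc k} (λ _ _ → 0#)       ≈⟨ det-rowSums≈0 {k} (λ _ _ → 0#) (λ _ → sum-replicate-zero (suc k)) ⟩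
      0#                             ≈⟨ zeroʳ _ ⟨
      [-1]^ suc k * 0#               ≈⟨ *-congˡ (treeSum-[]-nontree {F} (disconnected ∘ proj₁)) ⟨
      [-1]^ suc k * treeSum F []     ∎
      where
      open Components C
      disconnected : ¬ Connected (F ʳ++ [])
      disconnected connected = 0≢1+n (≡.trans (≡.sym (proj₂ (surjective zero)))
        (≡.trans (complete (Connected-mono (Any.reverse⁻ {xs = F}) connected _ _))
          (proj₂ (surjective (suc zero)))))
    matrixTree {k} {F} {π} ((a , b) ∷ E) C fresh with π a ≟ π b
    ... | yes πa≡πb = begin
      det (minor (laplacian ((a , b) ∷ E) π) zero zero)
        ≈⟨ det-cong (λ i j → laplacian-loop {π = π} E πa≡πb (suc i) (suc j)) ⟩
      det (minor (laplacian E π) zero zero)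
        ≈⟨ matrixTree E C (fresh-skip fresh) ⟩
      [-1]^ k * treeSum F E
        ≈⟨ *-congˡ (+-identityˡ _) ⟨
      [-1]^ k * (0# ⊕ treeSum F E)
        ≈⟨ *-congˡ (+-congʳ (trans (*-congˡ (treeSum-cyclic ((a , b) ∷ F) E cyclic)) (zeroʳ _))) ⟨
      [-1]^ k * (L a b * treeSum ((a , b) ∷ F) E ⊕ treeSum F E)
        ≈⟨ *-congˡ (treeSum-∷ F a b E) ⟨
      [-1]^ k * treeSum F ((a , b) ∷ E) ∎
      where
      open Components C
      cyclic : ¬ Acyclic ((a , b) ∷ F)
      cyclic = ¬acyclic-∷ (≢-sym (<⇒≢ (All.head (Fresh.ordered fresh))))
        (All.head (Fresh.unlinked fresh)) (sound πa≡πb)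
    matrixTree {zero} {F} {π} ((a , b) ∷ E) C fresh | no πa≢πb with π a | π b
    ... | zero | zero = contradiction ≡.refl πa≢πb
    matrixTree {suc k} {F} {π} ((a , b) ∷ E) C fresh | no πa≢πb = begin
      det (minor (laplacian ((a , b) ∷ E) π) zero zero)
        ≈⟨ det-laplacian-∷ {π = π} πa≢πb E ⟩
      det (minor (laplacian E π) zero zero)
        ⊕ - (L a b * det (minor (laplacian E (merge πa≢πb ∘ π)) zero zero))
        ≈⟨ +-cong (matrixTree E C (fresh-skip fresh)) (-‿cong (*-congˡ
             (matrixTree E (components-∷ πa≢πb C) (fresh-select fresh)))) ⟩
      - 1# * [-1]^ k * S ⊕ - (L a b * ([-1]^ k * T))
        ≈⟨ +-comm _ _ ⟩
      - (L a b * ([-1]^ k * T)) ⊕ - 1# * [-1]^ k * S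
        -- Merging lowered `k` by one, so the minus sign of the contraction term supplies the factor
        -- missing from `[-1]^ suc k`.
        ≈⟨ +-congʳ (begin
             - (L a b * ([-1]^ k * T))      ≈⟨ -1*x≈-x _ ⟨
             - 1# * (L a b * ([-1]^ k * T)) ≈⟨ *-congˡ (x∙yz≈y∙xz _ _ _) ⟩
             - 1# * ([-1]^ k * (L a b * T)) ≈⟨ *-assoc _ _ _ ⟨
             - 1# * [-1]^ k * (L a b * T)   ∎) ⟩
      - 1# * [-1]^ k * (L a b * T) ⊕ - 1# * [-1]^ k * S
        ≈⟨ distribˡ _ _ _ ⟨
      [-1]^ suc k * (L a b * T ⊕ S)
        ≈⟨ *-congˡ (treeSum-∷ F a b E) ⟨
      [-1]^ suc k * treeSum F ((a , b) ∷ E) ∎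
      where
      S = treeSum F E
      T = treeSum ((a , b) ∷ F) E

    -- Recovering the matrix as the Laplacian of the complete graph.

    incidence-≢ : ∀ {m} {a b i : Fin m} → a ≢ i → b ≢ i → incidence a b i ≈ 0#
    incidence-≢ a≢i b≢i = trans (+-cong (δ-≢ a≢i) (trans (-‿cong (δ-≢ b≢i)) -0#≈0#)) (+-identityˡ 0#)

    incidence-source : ∀ {m} {a b : Fin m} → a ≢ b → incidence a b a ≈ 1#
    incidence-source {a = a} a≢b = trans
      (+-cong (δ-refl a) (trans (-‿cong (δ-≢ (≢-sym a≢b))) -0#≈0#)) (+-identityʳ 1#)

    incidence-target : ∀ {m} {a b : Fin m} → a ≢ b → incidence a b b ≈ - 1#
    incidence-target {b = b} a≢b = trans (+-cong (δ-≢ a≢b) (-‿cong (δ-refl b))) (+-identityˡ _)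

    -- A nonzero product requires both `i` and `j` to be ends of the edge; as both pairs are
    -- increasing, they would then coincide.
    incidence-other : ∀ {m} {a b i j : Fin m} → a < b → i < j → (a , b) ≢ (i , j) →
      incidence a b i * incidence a b j ≈ 0#
    incidence-other {a = a} {b} {i} {j} a<b i<j ab≢ij with a ≟ i | b ≟ i
    ... | yes ≡.refl | _ = trans (*-congˡ (incidence-≢ {a = a} {b} {j} (<⇒≢ i<j) λ { ≡.refl → ab≢ij ≡.refl })) (zeroʳ _)
    ... | no _ | yes ≡.refl =
      trans (*-congˡ (incidence-≢ {a = a} {b} {j} (λ { ≡.refl → <-asym a<b i<j }) (<⇒≢ i<j))) (zeroʳ _)
    ... | no a≢i | no b≢i = trans (*-congʳ (incidence-≢ a≢i b≢i)) (zeroˡ _)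

    laplacian-skip : ∀ {a b i j} E → a < b → i < j → (a , b) ≢ (i , j) →
      laplacian ((a , b) ∷ E) id i j ≈ laplacian E id i j
    laplacian-skip {a} {b} {i} {j} E a<b i<j ab≢ij = trans (+-congˡ (begin
      - (L a b * (incidence a b i * incidence a b j)) ≈⟨ -‿cong (*-congˡ (incidence-other a<b i<j ab≢ij)) ⟩
      - (L a b * 0#)                                  ≈⟨ -‿cong (zeroʳ _) ⟩
      - 0#                                            ≈⟨ -0#≈0# ⟩
      0#                                              ∎)) (+-identityʳ _)

    laplacian-∉ : ∀ {E i j} → All (λ (a , b) → a < b) E → i < j → All (_≢ (i , j)) E →
      laplacian E id i j ≈ 0#
    laplacian-∉ []           i<j []         = refl
    laplacian-∉ {_ ∷ E} (a<b ∷ a<bs) i<j (e≢ ∷ es≢) =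
      trans (laplacian-skip E a<b i<j e≢) (laplacian-∉ a<bs i<j es≢)

    -- Exactly one edge contributes to this entry. Its incidence vector has the values 1 and -1
    -- there, and their product cancels the minus sign of `laplacian`.
    laplacian-∈ : ∀ {F E i j} → Fresh F E → i < j → (i , j) ∈ E → laplacian E id i j ≈ L i j
    laplacian-∈ {E = (i , j) ∷ E} record { ordered = _ ∷ o ; unique = e∉E ∷ _ } i<j (here ≡.refl) = begin
      laplacian E id i j ⊕ - (L i j * (incidence i j i * incidence i j j))
        ≈⟨ +-cong (laplacian-∉ o i<j (All.map (λ e≢ eq → e≢ (≡.sym eq)) e∉E))
             (-‿cong (*-congˡ (*-cong (incidence-source (<⇒≢ i<j)) (incidence-target (<⇒≢ i<j))))) ⟩
      0# ⊕ - (L i j * (1# * - 1#))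
        ≈⟨ +-identityˡ _ ⟩
      - (L i j * (1# * - 1#))
        ≈⟨ -‿cong (trans (*-congˡ (*-identityˡ _)) (sym (-‿distribʳ-* _ _))) ⟩
      - (- (L i j * 1#))
        ≈⟨ trans (-‿involutive _) (*-identityʳ _) ⟩
      L i j ∎
    laplacian-∈ {E = e ∷ E} fresh i<j (there ij∈E) = trans
      (laplacian-skip E (All.head (Fresh.ordered fresh)) i<j (All.lookup (e∉E (Fresh.unique fresh)) ij∈E))
      (laplacian-∈ (fresh-skip fresh) i<j ij∈E)
      where
      e∉E : Unique (e ∷ E) → All (e ≢_) E
      e∉E (p ∷ _) = p

  -- Since rows sum to zero, each diagonal entry is determined by the rest of its row.
  diagonal-unique : ∀ {n} {M N : Matrix n} → LaplaceLike M → LaplaceLike N →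
    (∀ i j → i ≢ j → M i j ≈ N i j) → ∀ i → M i i ≈ N i i
  diagonal-unique {suc n} {M} {N} M-laplace N-laplace M≈N i =
    +-cancelʳ (sum λ k → N i (punchIn i k)) _ _ (begin
      M i i ⊕ (sum λ k → N i (punchIn i k))
        ≈⟨ +-congˡ (sum-cong λ k → M≈N i (punchIn i k) (punchInᵢ≢i i k ∘ ≡.sym)) ⟨
      M i i ⊕ (sum λ k → M i (punchIn i k)) ≈⟨ sum-remove (M i) ⟨
      sum (M i)                             ≈⟨ LaplaceLike.rowSum≈0 M-laplace i ⟩
      0#                                    ≈⟨ LaplaceLike.rowSum≈0 N-laplace i ⟨
      sum (N i)                             ≈⟨ sum-remove (N i) ⟩
      N i i ⊕ (sum λ k → N i (punchIn i k)) ∎)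

  -- `laplacian` reads only the entries of `L` above the diagonal; symmetry of `L` gives those
  -- below, and the row sums give the diagonal.
  laplacian-pairs : ∀ {n} {L : Matrix n} → LaplaceLike L →
    ∀ i j → laplacian L (pairs n) id i j ≈ L i j
  laplacian-pairs {n} {L} L-laplace = all
    where
    M = laplacian L (pairs n) id
    M-laplace = laplacian-laplaceLike L (pairs n) id
    offDiagonal : ∀ i j → i ≢ j → M i j ≈ L i j
    offDiagonal i j i≢j with <-cmp i j
    ... | tri< i<j _ _ = laplacian-∈ L (fresh-pairs n) i<j (∈-pairs i<j)
    ... | tri≈ _ i≡j _ = contradiction i≡j i≢j
    ... | tri> _ _ j<i = trans (laplacian-symmetric L (pairs n) id i j)
      (trans (laplacian-∈ L (fresh-pairs n) j<i (∈-pairs j<i)) (LaplaceLike.symmetric L-laplace j i))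
    all : ∀ i j → M i j ≈ L i j
    all i j with i ≟ j
    ... | yes ≡.refl = diagonal-unique M-laplace L-laplace offDiagonal i
    ... | no  i≢j    = offDiagonal i j i≢j

theorem1 : ∀ {c ℓ} (R : CommutativeRing c ℓ) →
  let open CommutativeRing R hiding (_+_)
      open Matrices R in
  ∀ (m : ℕ) → let n = suc m in
  (L : Matrix n) → LaplaceLike L →
  ∀ i j → cofactor L i j ≈ [-1]^ (n + 1) * ∑trees n (λ τ → A[ τ ] L)
theorem1 R m L L-laplace i j = begin
  cofactor L i j
    ≈⟨ cofactor-constant L-laplace i j zero zero ⟩
  cofactor L zero zero
    ≈⟨ cofactor-diagonal L zero ⟩
  det (minor L zero zero)
    ≈⟨ det-cong (λ k l → laplacian-pairs L-laplace (suc k) (suc l)) ⟨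
  det (minor (laplacian L (pairs (suc m)) id) zero zero)
    -- Initially no edge is selected and each of the `m + 1` vertices is its own component, so `k`
    -- is `m`.
    ≈⟨ matrixTree L (pairs (suc m)) components-[] (fresh-pairs (suc m)) ⟩
  -- As `[] ʳ++ S` computes to `S`, this `treeSum` is `∑trees` by definition.
  [-1]^ m * treeSum L [] (pairs (suc m))
    ≈⟨ *-congʳ sign ⟨
  [-1]^ (suc m + 1) * ∑trees (suc m) (λ τ → A[ τ ] L) ∎
  where
  open CommutativeRing R hiding (_+_; zero)
  open Matrices R
  open Determinant R
  open MatrixTree R
  open import Relation.Binary.Reasoning.Setoid setoid
  -- The exponents `n + 1` and `m` differ by two.
  sign : [-1]^ (suc m + 1) ≈ [-1]^ m
  sign = begin
    [-1]^ (suc m + 1)           ≡⟨ ≡.cong (λ k → [-1]^ suc k) (ℕ.+-comm m 1) ⟩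
    - 1# * (- 1# * [-1]^ m)     ≈⟨ *-assoc _ _ _ ⟨
    (- 1# * - 1#) * [-1]^ m     ≈⟨ *-congʳ -1*-1≈1 ⟩
    1# * [-1]^ m                ≈⟨ *-identityˡ _ ⟩
    [-1]^ m                     ∎
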